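{- Let $P(q)$ be a polynomial. Then $$f_q(n)=\prod_{i=0}^{q-1}\bigl(n+P(i)\bigr)$$ is a two-level polynomial of degree $q$ (that is, with degree function $g(q)=q$) and infinite depth.
   Context: A numerical polynomial is $g\in\mathbb Q[x]$ with $g(q)\in\mathbb Z$ for all $q\in\mathbb Z$. Two-level polynomial: let $g$ be an eventually nonnegative numerical polynomial, $S=\{q\in\mathbb N: g(q)\ge0\}$, and $e:S\to\mathbb N\cup\{ -1,\infty\}$. A sequence of polynomials $\{f_q(n)\}_{q\in S}$, with $f_q$ of degree $g(q)$, is a two-level polynomial of degree function $g$ and depth function $e$ if, writing $f_q(n)=\sum_{r=0}^\infty c_r(q)n^{g(q)-r}$ with $c_r(q)=0$ for $r>g(q)$, there exist polynomials $\{\varphi_r(q)\}_{r\ge0}$ such that $c_r(q)=\varphi_r(q)$ for every $q\in S$ and every $r\le e(q)$. Infinite depth means $e(q)=\infty$ for all $q\in S$. The empty product is $1$. -}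

module Defs where

open import Algebra.Apartness.Bundles using (HeytingField; HeytingCommutativeRing)
open import Algebra.Bundles using (CommutativeRing)
open import Algebra.Bundles.Raw using (RawRing)
import Algebra.Definitions.RawMonoid as RawMonoidDefs
open import Data.Bool.Base using (if_then_else_)
open import Data.Empty using (⊥)
open import Data.Integer.Base as ℤ using (ℤ; +_)
open import Data.List.Base using (List; []; _∷_; map)
open import Data.Nat.Base as ℕ using (ℕ; zero; suc; _∸_; _≤ᵇ_)
open import Data.Product.Base using (Σ; ∃; _×_; _,_; proj₁)
open import Data.Rational.Base as ℚ using (ℚ; 0ℚ; +-*-rawRing)
open import Data.Unit.Base using (⊤)
open import Level using (_⊔_)
open import Relation.Binary.PropositionalEquality.Core using (_≡_)

-- A polynomial a₀ + a₁x + a₂x² + ⋯ is the list a₀ ∷ a₁ ∷ a₂ ∷ ⋯ of its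
-- coefficients.  Trailing zeros are allowed, so the length of the list does
-- not determine the degree.

module Polynomial {c ℓ} (R : RawRing c ℓ) where
  open RawRing R

  Poly : Set c
  Poly = List Carrier

  coeff : Poly → ℕ → Carrier
  coeff []      k       = 0#
  coeff (a ∷ p) zero    = a
  coeff (a ∷ p) (suc k) = coeff p k

  eval : Poly → Carrier → Carrier
  eval []      x = 0#
  eval (a ∷ p) x = a + x * eval p x

  C : Carrier → Poly
  C a = a ∷ []

  X : Poly
  X = 0# ∷ 1# ∷ []

  infixl 6 _+ₚ_
  infixl 7 _*ₚ_

  _+ₚ_ : Poly → Poly → Poly
  []      +ₚ q       = q
  (a ∷ p) +ₚ []      = a ∷ p
  (a ∷ p) +ₚ (b ∷ q) = (a + b) ∷ (p +ₚ q)

  _*ₚ_ : Poly → Poly → Poly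
  []      *ₚ q = []
  (a ∷ p) *ₚ q = map (a *_) q +ₚ (0# ∷ (p *ₚ q))

  -- ∏ₚ n F = F 0 * F 1 * ⋯ * F (n - 1)
  ∏ₚ : ℕ → (ℕ → Poly) → Poly
  ∏ₚ zero    F = C 1#
  ∏ₚ (suc n) F = ∏ₚ n F *ₚ F n

module ℚ[x] = Polynomial +-*-rawRing

fromℤ : ℤ → ℚ
fromℤ z = z ℚ./ 1

IsNumerical : ℚ[x].Poly → Set
IsNumerical g = (q : ℤ) → ∃ λ (k : ℤ) → ℚ[x].eval g (fromℤ q) ≡ fromℤ k

EventuallyNonNegative : ℚ[x].Poly → Set
EventuallyNonNegative g =
  ∃ λ (N : ℕ) → (q : ℕ) → N ℕ.≤ q → 0ℚ ℚ.≤ ℚ[x].eval g (fromℤ (+ q))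

-- S g = { q ∈ ℕ : g(q) ≥ 0 }
S : ℚ[x].Poly → Set
S g = Σ ℕ λ q → 0ℚ ℚ.≤ ℚ[x].eval g (fromℤ (+ q))

-- ℕ ∪ {-1, ∞}
data Depth : Set where
  -1ᵈ : Depth
  fin : ℕ → Depth
  ∞   : Depth

infix 4 _≤ᵈ_

_≤ᵈ_ : ℕ → Depth → Set
r ≤ᵈ -1ᵈ   = ⊥
r ≤ᵈ fin e = r ℕ.≤ e
r ≤ᵈ ∞     = ⊤

module TwoLevel {c ℓ₁ ℓ₂} (K : HeytingField c ℓ₁ ℓ₂) where
  open HeytingField K using (Carrier; _≈_; _#_; 0#; 1#; heytingCommutativeRing)

  rawRing : RawRing c ℓ₁
  rawRing = CommutativeRing.rawRing
              (HeytingCommutativeRing.commutativeRing heytingCommutativeRing)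

  open Polynomial rawRing public

  fromℕ : ℕ → Carrier
  fromℕ n = n · 1#
    where open RawMonoidDefs (RawRing.+-rawMonoid rawRing) using () renaming (_×_ to _·_)

  CharacteristicZero : Set ℓ₂
  CharacteristicZero = (n : ℕ) → fromℕ (suc n) # 0#

  -- Apartness from 0# is the notion of being nonzero in a Heyting field.
  HasDegree : Poly → ℕ → Set (ℓ₁ ⊔ ℓ₂)
  HasDegree p d = (coeff p d # 0#) × (∀ k → d ℕ.< k → coeff p k ≈ 0#)

  -- The coefficient of n^(d - r) in p, and 0 when r > d.
  coeffFromTop : Poly → ℕ → ℕ → Carrier
  coeffFromTop p d r = if r ≤ᵇ d then coeff p (d ∸ r) else 0#

  record IsTwoLevel (g : ℚ[x].Poly) (e : S g → Depth) (f : S g → Poly)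
                  : Set (c ⊔ ℓ₁ ⊔ ℓ₂) where
    field
      numerical             : IsNumerical g
      eventuallyNonNegative : EventuallyNonNegative g

    -- g(q) as a natural number; taking the absolute value loses nothing,
    -- since g(q) ≥ 0 on S g.
    degreeAt : S g → ℕ
    degreeAt (q , _) = ℤ.∣ proj₁ (numerical (+ q)) ∣

    field
      hasDegree      : ∀ s → HasDegree (f s) (degreeAt s)
      φ              : ℕ → Poly
      topCoeff≈evalφ : ∀ s r → r ≤ᵈ e s →
                       coeffFromTop (f s) (degreeAt s) r ≈ eval (φ r) (fromℕ (proj₁ s))

-- The coefficient c_r(q) is the r-th elementary symmetric function of
-- P(0), …, P(q - 1), so c_{r+1}(q + 1) = c_{r+1}(q) + P(q) c_r(q).  Hence
-- c_{r+1}(q) = ∑_{i<q} P(i) c_r(i), and since partial sums of a polynomial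
-- are again polynomial in characteristic zero, so is each c_r.

{-# OPTIONS --safe #-}
module Submission where

open import Defs
open import Algebra.Apartness.Bundles using (HeytingField; HeytingCommutativeRing)
open import Algebra.Bundles using (CommutativeRing)
import Algebra.Apartness.Properties.HeytingCommutativeRing as HeytingCommutativeRingProperties
import Algebra.Properties.Ring as RingProperties
import Algebra.Solver.Ring.NaturalCoefficients.Default as SemiringSolver
open import Data.Integer.Base using (+_)
open import Data.List.Base using ([]; _∷_; map)
open import Data.Nat.Base using (ℕ; zero; suc; _<_; s<s)
open import Data.Nat.Properties using (m<n⇒m<1+n; n<1+n)
open import Data.Product.Base using (proj₁; proj₂; _,_)
import Data.Rational.Properties as ℚ
open import Data.Rational.Base using (0ℚ) renaming (_≤_ to _≤ℚ_)
open import Relation.Binary.PropositionalEquality.Core as ≡ using (_≡_)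
import Relation.Binary.Reasoning.Setoid as ≈-Reasoning

-- Evaluation as a ring homomorphism, and multiplication by X + a.

module PolynomialProperties {c ℓ} (R : CommutativeRing c ℓ) where
  open CommutativeRing R
  open Polynomial rawRing
  open SemiringSolver commutativeSemiring using (solve; _:+_; _:*_; _:=_)
  open ≈-Reasoning setoid

  eval-+ : ∀ p q x → eval (p +ₚ q) x ≈ eval p x + eval q x
  eval-+ []      q       x = sym (+-identityˡ _)
  eval-+ (a ∷ p) []      x = sym (+-identityʳ _)
  eval-+ (a ∷ p) (b ∷ q) x = begin
    (a + b) + x * eval (p +ₚ q) x           ≈⟨ +-congˡ (*-congˡ (eval-+ p q x)) ⟩
    (a + b) + x * (eval p x + eval q x)     ≈⟨ solve 5 (λ a b x p q →
      (a :+ b) :+ x :* (p :+ q) := (a :+ x :* p) :+ (b :+ x :* q)) refl a b x _ _ ⟩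
    (a + x * eval p x) + (b + x * eval q x) ∎

  eval-map-* : ∀ a p x → eval (map (a *_) p) x ≈ a * eval p x
  eval-map-* a []      x = sym (zeroʳ a)
  eval-map-* a (b ∷ p) x = begin
    a * b + x * eval (map (a *_) p) x ≈⟨ +-congˡ (*-congˡ (eval-map-* a p x)) ⟩
    a * b + x * (a * eval p x)        ≈⟨ solve 4 (λ a b x p →
      a :* b :+ x :* (a :* p) := a :* (b :+ x :* p)) refl a b x _ ⟩
    a * (b + x * eval p x)            ∎

  eval-* : ∀ p q x → eval (p *ₚ q) x ≈ eval p x * eval q x
  eval-* []      q x = sym (zeroˡ _)
  eval-* (a ∷ p) q x = begin
    eval (map (a *_) q +ₚ (0# ∷ p *ₚ q)) x
      ≈⟨ eval-+ (map (a *_) q) _ x ⟩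
    eval (map (a *_) q) x + (0# + x * eval (p *ₚ q) x)
      ≈⟨ +-cong (eval-map-* a q x) (trans (+-identityˡ _) (*-congˡ (eval-* p q x))) ⟩
    a * eval q x + x * (eval p x * eval q x)
      ≈⟨ solve 4 (λ a x p q → a :* q :+ x :* (p :* q) := (a :+ x :* p) :* q) refl a x _ _ ⟩
    (a + x * eval p x) * eval q x ∎

  eval-C : ∀ a x → eval (C a) x ≈ a
  eval-C a x = trans (+-congˡ (zeroʳ x)) (+-identityʳ a)

  eval-X : ∀ x → eval X x ≈ x
  eval-X x = trans (+-identityˡ _) (trans (*-congˡ (eval-C 1# x)) (*-identityʳ x))

  eval-X+C : ∀ a x → eval (X +ₚ C a) x ≈ x + a
  eval-X+C a x = trans (eval-+ X (C a) x) (+-cong (eval-X x) (eval-C a x))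

  coeff-+ : ∀ p q k → coeff (p +ₚ q) k ≈ coeff p k + coeff q k
  coeff-+ []      q       k       = sym (+-identityˡ _)
  coeff-+ (a ∷ p) []      k       = sym (+-identityʳ _)
  coeff-+ (a ∷ p) (b ∷ q) zero    = refl
  coeff-+ (a ∷ p) (b ∷ q) (suc k) = coeff-+ p q k

  coeff-*[X+C]-zero : ∀ p a → coeff (p *ₚ (X +ₚ C a)) 0 ≈ a * coeff p 0
  coeff-*[X+C]-zero []      a = sym (zeroʳ a)
  coeff-*[X+C]-zero (b ∷ p) a =
    trans (+-identityʳ _) (trans (*-congˡ (+-identityˡ a)) (*-comm b a))

  coeff-*[X+C]-suc : ∀ p a k →
    coeff (p *ₚ (X +ₚ C a)) (suc k) ≈ coeff p k + a * coeff p (suc k)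
  coeff-*[X+C]-suc []      a k       = sym (trans (+-identityˡ _) (zeroʳ a))
  coeff-*[X+C]-suc (b ∷ p) a zero    =
    -- Dropping the constant term leaves `b * 1#` from the row b(X + a), added to the unshifted
    -- product for the tail.
    trans (coeff-+ (b * 1# ∷ []) (p *ₚ (X +ₚ C a)) 0)
          (+-cong (*-identityʳ b) (coeff-*[X+C]-zero p a))
  coeff-*[X+C]-suc (b ∷ p) a (suc k) =
    trans (coeff-+ (b * 1# ∷ []) (p *ₚ (X +ₚ C a)) (suc k))
          (trans (+-identityˡ _) (coeff-*[X+C]-suc p a k))

-- Products of monic linear factors, with coefficients counted from the top.

module MonicLinearProduct {c ℓ₁ ℓ₂} (K : HeytingField c ℓ₁ ℓ₂) where
  open TwoLevel K
  open HeytingField K using (heytingCommutativeRing)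
  open CommutativeRing (HeytingCommutativeRing.commutativeRing heytingCommutativeRing)
    hiding (rawRing; zero)
  open PolynomialProperties (HeytingCommutativeRing.commutativeRing heytingCommutativeRing)

  ∏[X+_] : (ℕ → Carrier) → ℕ → Poly
  ∏[X+ a ] q = ∏ₚ q (λ i → X +ₚ C (a i))

  -- The other contribution, a times the coefficient of degree d + 1, vanishes by hypothesis.
  coeffFromTop-*[X+C]-zero : ∀ p a d → coeff p (suc d) ≈ 0# →
    coeffFromTop (p *ₚ (X +ₚ C a)) (suc d) 0 ≈ coeffFromTop p d 0
  coeffFromTop-*[X+C]-zero p a d p≈0 =
    trans (coeff-*[X+C]-suc p a d)
          (trans (+-congˡ (trans (*-congˡ p≈0) (zeroʳ a))) (+-identityʳ _))

  -- For r < d, degree d - r of the product collects degree d - r - 1 of p through X and degree d -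
  -- r through a. Both indices drop together until one is zero.
  coeffFromTop-*[X+C]-suc : ∀ p a d r →
    coeffFromTop (p *ₚ (X +ₚ C a)) (suc d) (suc r) ≈
    coeffFromTop p d (suc r) + a * coeffFromTop p d r
  -- The constant coefficient of the product has no part coming from X; the default 0 of
  -- `coeffFromTop` stands for that missing summand.
  coeffFromTop-*[X+C]-suc p a zero    zero    =
    trans (coeff-*[X+C]-zero p a) (sym (+-identityˡ _))
  coeffFromTop-*[X+C]-suc p a (suc d) zero    = coeff-*[X+C]-suc p a d
  coeffFromTop-*[X+C]-suc p a zero    (suc r) = sym (trans (+-identityˡ _) (zeroʳ a))
  -- r is split once more because 0 ≤ᵇ d and suc r ≤ᵇ d unfold differently.
  coeffFromTop-*[X+C]-suc p a (suc d) (suc zero)    = coeffFromTop-*[X+C]-suc p a d 0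
  coeffFromTop-*[X+C]-suc p a (suc d) (suc (suc r)) = coeffFromTop-*[X+C]-suc p a d (suc r)

  coeff-∏-above : ∀ a q k → q < k → coeff (∏[X+ a ] q) k ≈ 0#
  coeff-∏-above a zero    (suc k) _         = refl
  coeff-∏-above a (suc q) (suc k) (s<s q<k) = begin
    coeff (∏[X+ a ] (suc q)) (suc k)
      ≈⟨ coeff-*[X+C]-suc (∏[X+ a ] q) (a q) k ⟩
    coeff (∏[X+ a ] q) k + a q * coeff (∏[X+ a ] q) (suc k)
      ≈⟨ +-cong (coeff-∏-above a q k q<k) (*-congˡ (coeff-∏-above a q (suc k) (m<n⇒m<1+n q<k))) ⟩
    0# + a q * 0#
      ≈⟨ trans (+-identityˡ _) (zeroʳ (a q)) ⟩
    0# ∎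
    where open ≈-Reasoning setoid

  -- The exact value serves twice: it makes the degree exactly q, and it gives c_0 = 1.
  leadingCoeff-∏ : ∀ a q → coeffFromTop (∏[X+ a ] q) q 0 ≈ 1#
  leadingCoeff-∏ a zero    = refl
  leadingCoeff-∏ a (suc q) =
    trans (coeffFromTop-*[X+C]-zero (∏[X+ a ] q) (a q) q (coeff-∏-above a q (suc q) (n<1+n q)))
          (leadingCoeff-∏ a q)

-- Finite differences and summation of polynomials in characteristic zero.

module PartialSums {c ℓ₁ ℓ₂} (K : HeytingField c ℓ₁ ℓ₂)
                   (char0 : TwoLevel.CharacteristicZero K) where
  open TwoLevel K
  open HeytingField K using (heytingCommutativeRing; #⇒invertible)
  open HeytingCommutativeRingProperties heytingCommutativeRing using (x-0≈x)
  open CommutativeRing (HeytingCommutativeRing.commutativeRing heytingCommutativeRing)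
    hiding (rawRing; zero)
  open PolynomialProperties (HeytingCommutativeRing.commutativeRing heytingCommutativeRing)
  open SemiringSolver commutativeSemiring using (solve; _:+_; _:*_; _:=_)
  open ≈-Reasoning setoid

  1/suc : ℕ → Carrier
  1/suc k = proj₁ (#⇒invertible (char0 k))

  1/suc-inverseˡ : ∀ k → 1/suc k * fromℕ (suc k) ≈ 1#
  1/suc-inverseˡ k =
    -- `#⇒invertible` inverts the difference `fromℕ (suc k) - 0#`, so the subtraction of zero has to
    -- be undone.
    trans (*-congˡ (sym (x-0≈x _))) (proj₁ (proj₂ (#⇒invertible (char0 k))))

  -- The basis suited to summation: the forward difference of (x)ₖ₊₁ is (k + 1)(x)ₖ, so summing only
  -- divides by k + 1.
  fallingFactorial : ℕ → Poly
  fallingFactorial k = ∏ₚ k (λ j → X +ₚ C (- fromℕ j))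

  eval-fallingFactorial-suc : ∀ k x →
    eval (fallingFactorial (suc k)) x ≈ eval (fallingFactorial k) x * (x - fromℕ k)
  eval-fallingFactorial-suc k x =
    trans (eval-* (fallingFactorial k) _ x) (*-congˡ (eval-X+C (- fromℕ k) x))

  x≈[x-y]+y : ∀ x y → x ≈ (x - y) + y
  x≈[x-y]+y x y =
    sym (trans (+-assoc x (- y) y) (trans (+-congˡ (-‿inverseˡ y)) (+-identityʳ x)))

  [1+x]-[1+y]≈x-y : ∀ x y → (1# + x) - (1# + y) ≈ x - y
  [1+x]-[1+y]≈x-y x y = begin
    (1# + x) - (1# + y)       ≈⟨ +-congˡ (sym (-‿+-comm 1# y)) ⟩
    (1# + x) + (- 1# + - y)   ≈⟨ solve 4 (λ a b x y →
      (a :+ x) :+ (b :+ y) := (a :+ b) :+ (x :+ y)) refl 1# (- 1#) x (- y) ⟩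
    (1# - 1#) + (x - y)       ≈⟨ +-congʳ (-‿inverseʳ 1#) ⟩
    0# + (x - y)              ≈⟨ +-identityˡ _ ⟩
    x - y                     ∎
    where open RingProperties ring using (-‿+-comm)

  -- Raising x by one turns the factor x - j into x - (j - 1), so the first factor becomes 1 + x and
  -- the others reproduce (x)ₖ. As `∏ₚ` peels off the last factor, the first is reached by induction
  -- on k.
  eval-fallingFactorial-shift : ∀ k x →
    eval (fallingFactorial (suc k)) (1# + x) ≈ (1# + x) * eval (fallingFactorial k) x
  eval-fallingFactorial-shift zero    x = begin
    eval (fallingFactorial 1) (1# + x)     ≈⟨ eval-fallingFactorial-suc 0 (1# + x) ⟩
    eval (C 1#) (1# + x) * (1# + x - 0#)   ≈⟨ *-cong (trans (eval-C 1# _) (sym (eval-C 1# x))) (x-0≈x _) ⟩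
    eval (C 1#) x * (1# + x)               ≈⟨ *-comm _ _ ⟩
    (1# + x) * eval (C 1#) x               ∎
  eval-fallingFactorial-shift (suc k) x = begin
    eval (fallingFactorial (suc (suc k))) (1# + x)
      ≈⟨ eval-fallingFactorial-suc (suc k) (1# + x) ⟩
    eval (fallingFactorial (suc k)) (1# + x) * ((1# + x) - (1# + fromℕ k))
      ≈⟨ *-cong (eval-fallingFactorial-shift k x) ([1+x]-[1+y]≈x-y x (fromℕ k)) ⟩
    (1# + x) * eval (fallingFactorial k) x * (x - fromℕ k)
      ≈⟨ *-assoc _ _ _ ⟩
    (1# + x) * (eval (fallingFactorial k) x * (x - fromℕ k))
      ≈⟨ *-congˡ (eval-fallingFactorial-suc k x) ⟨
    (1# + x) * eval (fallingFactorial (suc k)) x ∎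

  -- Splitting 1 + x as (x - k) + (k + 1) in the shifted value (1 + x)(x)ₖ yields (x)ₖ₊₁ and the
  -- remainder (k + 1)(x)ₖ.
  eval-fallingFactorial-Δ : ∀ k x →
    eval (fallingFactorial (suc k)) (1# + x) ≈
    eval (fallingFactorial (suc k)) x + fromℕ (suc k) * eval (fallingFactorial k) x
  eval-fallingFactorial-Δ k x = begin
    eval (fallingFactorial (suc k)) (1# + x)
      ≈⟨ eval-fallingFactorial-shift k x ⟩
    (1# + x) * F
      ≈⟨ *-congʳ (+-congˡ (x≈[x-y]+y x (fromℕ k))) ⟩
    (1# + ((x - fromℕ k) + fromℕ k)) * F
      ≈⟨ solve 4 (λ e y n F → (e :+ (y :+ n)) :* F := F :* y :+ (e :+ n) :* F)
           refl 1# (x - fromℕ k) (fromℕ k) F ⟩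
    F * (x - fromℕ k) + fromℕ (suc k) * F
      ≈⟨ +-congʳ (eval-fallingFactorial-suc k x) ⟨
    eval (fallingFactorial (suc k)) x + fromℕ (suc k) * F ∎
    where F = eval (fallingFactorial k) x

  -- An antidifference of p · x(x - 1)⋯(x - k + 1).  Carrying the falling
  -- factorial along makes the recursion on p structural, because
  -- x · (x)ₖ = (x)ₖ₊₁ + k · (x)ₖ.
  antidifference : ℕ → Poly → Poly
  antidifference k []      = []
  antidifference k (a ∷ p) =
    C (a * 1/suc k) *ₚ fallingFactorial (suc k) +ₚ
    (antidifference (suc k) p +ₚ C (fromℕ k) *ₚ antidifference k p)

  eval-antidifference-∷ : ∀ k a p x →
    eval (antidifference k (a ∷ p)) x ≈
    a * 1/suc k * eval (fallingFactorial (suc k)) x +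
    (eval (antidifference (suc k) p) x + fromℕ k * eval (antidifference k p) x)
  eval-antidifference-∷ k a p x =
    trans (eval-+ (C (a * 1/suc k) *ₚ fallingFactorial (suc k)) _ x)
      (+-cong (eval-C* (a * 1/suc k) (fallingFactorial (suc k)))
        (trans (eval-+ (antidifference (suc k) p) _ x)
          (+-congˡ (eval-C* (fromℕ k) (antidifference k p)))))
    where
    eval-C* : ∀ b q → eval (C b *ₚ q) x ≈ b * eval q x
    eval-C* b q = trans (eval-* (C b) q x) (*-congʳ (eval-C b x))

  -- For a list `a ∷ p`, the head contributes a(x)ₖ. The tail must contribute x p(x)(x)ₖ, which the
  -- induction hypotheses at k + 1 and k supply as p(x)(x - k)(x)ₖ and k p(x)(x)ₖ.
  eval-antidifference-Δ : ∀ k p x →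
    eval (antidifference k p) (1# + x) ≈
    eval (antidifference k p) x + eval p x * eval (fallingFactorial k) x
  eval-antidifference-Δ k []      x = sym (trans (+-identityˡ _) (zeroˡ _))
  eval-antidifference-Δ k (a ∷ p) x = begin
    eval (antidifference k (a ∷ p)) (1# + x)
      ≈⟨ eval-antidifference-∷ k a p (1# + x) ⟩
    a * i * eval (fallingFactorial (suc k)) (1# + x) +
    (eval (antidifference (suc k) p) (1# + x) + n * eval (antidifference k p) (1# + x))
      ≈⟨ +-cong (*-congˡ (eval-fallingFactorial-Δ k x))
                (+-cong (trans (eval-antidifference-Δ (suc k) p x)
                               (+-congˡ (*-congˡ (eval-fallingFactorial-suc k x))))
                        (*-congˡ (eval-antidifference-Δ k p x))) ⟩
    a * i * (F′ + fromℕ (suc k) * F) + ((A₁ + P * (F * y)) + n * (A₀ + P * F))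
      -- The regrouping isolates `i * m`, which is 1, and `y + n`, which is x.
      ≈⟨ solve 10 (λ a i m n y P F F′ A₀ A₁ →
           a :* i :* (F′ :+ m :* F) :+ ((A₁ :+ P :* (F :* y)) :+ n :* (A₀ :+ P :* F)) :=
           (a :* i :* F′ :+ (A₁ :+ n :* A₀)) :+ (a :* (i :* m) :+ (y :+ n) :* P) :* F)
           refl a i (fromℕ (suc k)) n y P F F′ A₀ A₁ ⟩
    (a * i * F′ + (A₁ + n * A₀)) + (a * (i * fromℕ (suc k)) + (y + n) * P) * F
      ≈⟨ +-cong (sym (eval-antidifference-∷ k a p x))
           (*-congʳ (+-cong (trans (*-congˡ (1/suc-inverseˡ k)) (*-identityʳ a))
                            (*-congʳ (sym (x≈[x-y]+y x n))))) ⟩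
    eval (antidifference k (a ∷ p)) x + (a + x * P) * F ∎
    where
    i  = 1/suc k
    n  = fromℕ k
    y  = x - n
    P  = eval p x
    F  = eval (fallingFactorial k) x
    F′ = eval (fallingFactorial (suc k)) x
    A₀ = eval (antidifference k p) x
    A₁ = eval (antidifference (suc k) p) x

  -- At k = 0 the falling factorial is 1, so p itself is summed. Subtracting the value at 0 makes
  -- the empty sum vanish, so the value at a natural number q is ∑_{i<q} p(i).
  partialSum : Poly → Poly
  partialSum p = antidifference 0 p +ₚ C (- eval (antidifference 0 p) 0#)

  eval-partialSum : ∀ p x →
    eval (partialSum p) x ≈ eval (antidifference 0 p) x - eval (antidifference 0 p) 0#
  eval-partialSum p x = trans (eval-+ (antidifference 0 p) _ x) (+-congˡ (eval-C _ x))

  eval-partialSum-zero : ∀ p → eval (partialSum p) 0# ≈ 0#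
  eval-partialSum-zero p = trans (eval-partialSum p 0#) (-‿inverseʳ _)

  -- With the argument written `1# + x` this applies to naturals directly, since `fromℕ (suc q)`
  -- unfolds to `1# + fromℕ q`.
  eval-partialSum-suc : ∀ p x →
    eval (partialSum p) (1# + x) ≈ eval (partialSum p) x + eval p x
  eval-partialSum-suc p x = begin
    eval (partialSum p) (1# + x)
      ≈⟨ eval-partialSum p (1# + x) ⟩
    eval (antidifference 0 p) (1# + x) - A₀
      ≈⟨ +-congʳ (eval-antidifference-Δ 0 p x) ⟩
    A + eval p x * eval (C 1#) x - A₀
      ≈⟨ +-congʳ (+-congˡ (trans (*-congˡ (eval-C 1# x)) (*-identityʳ _))) ⟩
    A + eval p x - A₀
      ≈⟨ solve 3 (λ A P B → A :+ P :+ B := A :+ B :+ P) refl A (eval p x) (- A₀) ⟩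
    A - A₀ + eval p x
      ≈⟨ +-congʳ (eval-partialSum p x) ⟨
    eval (partialSum p) x + eval p x ∎
    where
    A  = eval (antidifference 0 p) x
    A₀ = eval (antidifference 0 p) 0#

-- The coefficients c_r(q) as polynomials in q.

module TopCoefficients {c ℓ₁ ℓ₂} (K : HeytingField c ℓ₁ ℓ₂)
                       (char0 : TwoLevel.CharacteristicZero K)
                       (P : TwoLevel.Poly K) where
  open TwoLevel K
  open HeytingField K using (heytingCommutativeRing)
  open CommutativeRing (HeytingCommutativeRing.commutativeRing heytingCommutativeRing)
    hiding (rawRing; zero)
  open PolynomialProperties (HeytingCommutativeRing.commutativeRing heytingCommutativeRing)
  open MonicLinearProduct K
  open PartialSums K char0
  open ≈-Reasoning setoid

  P[_] : ℕ → Carrier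
  P[ i ] = eval P (fromℕ i)

  -- The summation of P(i) c_r(i) over i < q is carried out on polynomials, so the recursion is on r
  -- alone and q stays the variable.
  topCoeff : ℕ → Poly
  topCoeff zero    = C 1#
  topCoeff (suc r) = partialSum (P *ₚ topCoeff r)

  -- Both sides satisfy the same recurrence in q and r and agree where q or r is zero. The range of
  -- r includes r > q, as infinite depth demands.
  coeffFromTop-∏ : ∀ q r →
    coeffFromTop (∏[X+ P[_] ] q) q r ≈ eval (topCoeff r) (fromℕ q)
  coeffFromTop-∏ q       zero    =
    trans (leadingCoeff-∏ P[_] q) (sym (eval-C 1# (fromℕ q)))
  -- The empty product has degree 0, so the left side is the default 0 of `coeffFromTop`; the right
  -- side is an empty sum.
  coeffFromTop-∏ zero    (suc r) = sym (eval-partialSum-zero (P *ₚ topCoeff r))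
  coeffFromTop-∏ (suc q) (suc r) = begin
    coeffFromTop (∏[X+ P[_] ] (suc q)) (suc q) (suc r)
      ≈⟨ coeffFromTop-*[X+C]-suc (∏[X+ P[_] ] q) P[ q ] q r ⟩
    coeffFromTop (∏[X+ P[_] ] q) q (suc r) + P[ q ] * coeffFromTop (∏[X+ P[_] ] q) q r
      ≈⟨ +-cong (coeffFromTop-∏ q (suc r)) (*-congˡ (coeffFromTop-∏ q r)) ⟩
    eval (topCoeff (suc r)) (fromℕ q) + P[ q ] * eval (topCoeff r) (fromℕ q)
      ≈⟨ +-congˡ (eval-* P (topCoeff r) (fromℕ q)) ⟨
    eval (topCoeff (suc r)) (fromℕ q) + eval (P *ₚ topCoeff r) (fromℕ q)
      ≈⟨ eval-partialSum-suc (P *ₚ topCoeff r) (fromℕ q) ⟨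
    eval (topCoeff (suc r)) (fromℕ (suc q)) ∎

-- The degree function g(q) = q and the assembly of the result.

evalℚ-X : ∀ x → ℚ[x].eval ℚ[x].X x ≡ x
evalℚ-X = PolynomialProperties.eval-X ℚ.+-*-commutativeRing

0≤fromℤ+ : ∀ q → 0ℚ ≤ℚ fromℤ (+ q)
0≤fromℤ+ q = ℚ.nonNegative⁻¹ _ {{ℚ.normalize-nonNeg q 1}}

proposition1p6 : ∀ {c ℓ₁ ℓ₂} (K : HeytingField c ℓ₁ ℓ₂) → let open TwoLevel K in
    CharacteristicZero →
    (P : Poly) →
    IsTwoLevel ℚ[x].X (λ _ → ∞) (λ s → ∏ₚ (proj₁ s) (λ i → X +ₚ C (eval P (fromℕ i))))
proposition1p6 K char0 P = record
  -- With q itself as the integer value of g at q, `degreeAt` computes to q at each natural number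
  -- q.
  { numerical             = λ q → q , evalℚ-X (fromℤ q)
  ; eventuallyNonNegative =
      0 , λ q _ → ≡.subst (0ℚ ≤ℚ_) (≡.sym (evalℚ-X (fromℤ (+ q)))) (0≤fromℤ+ q)
  ; hasDegree             = λ (q , _) →
      #-congʳ (sym (leadingCoeff-∏ P[_] q)) 1#0 , coeff-∏-above P[_] q
  ; φ                     = topCoeff
  ; topCoeff≈evalφ        = λ (q , _) r _ → coeffFromTop-∏ q r
  }
  where
  open HeytingField K using (heytingCommutativeRing; sym)
  open HeytingCommutativeRingProperties heytingCommutativeRing using (#-congʳ; 1#0)
  open MonicLinearProduct K
  open TopCoefficients K char0 P
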